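{- Let $\Gamma$ be a finite simple graph on $v$ vertices, let $s$ be a positive integer with $s<v$, and let $k,\lambda$ be real numbers. Define $$T_1:=v-(3+2k)s+2s^2,\qquad T_2:=4(v-s)\big((3+\lambda)s^2-s^3-(2+\lambda)s\big),$$ $$T_3:=(v-s)\left(1-\left|2\left(\frac{ -v+(3+2k)s-2s^2}{2(v-s)}-\left\lfloor\frac{ -v+(3+2k)s-2s^2}{2(v-s)}\right\rfloor\right)-1\right|\right),$$ and $\mathrm{CE}_\Gamma(s,k,\lambda):=T_1^2-T_2-T_3^2$. If $\mathrm{CE}_\Gamma(s,k,\lambda)>0$, then no $s$-clique $S$ of $\Gamma$ satisfies $(\langle k\rangle_S,\langle\lambda\rangle_S)=(k,\lambda)$.
   Context: For a graph $\Gamma$ and a vertex $u$, $\Gamma(u)$ denotes the set of neighbours of $u$. An $s$-clique is a set $S$ of $s$ pairwise adjacent vertices. For a clique $S$, $$\langle k\rangle_S:=\frac{1}{|S|}\sum_{u\in S}\deg_\Gamma(u),\qquad \langle\lambda\rangle_S:=\binom{|S|}{2}^{ -1}\sum_{\{u,w\}\in\binom{S}{2}}|\Gamma(u)\cap\Gamma(w)|.$$ For $|S|=1$ the second average is empty and is taken to be $0$. -}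

module Defs where

open import Data.Bool using (if_then_else_)
open import Data.Fin using (Fin; _<?_)
open import Data.Fin.Subset using (Subset; _∈_; ∣_∣; _∩_)
open import Data.Fin.Subset.Properties using (_∈?_)
open import Data.Integer as ℤ using (ℤ)
open import Data.Nat as ℕ using (ℕ; zero; suc)
open import Data.Nat.Combinatorics using (_C_)
import Data.Nat.Properties as ℕ
open import Data.Product using (∃; ∃-syntax; _×_; _,_)
open import Data.Rational as ℚ using (ℚ; 0ℚ; 1ℚ)
import Data.Rational.Properties as ℚ
open import Data.Sum using (inj₁; inj₂)
open import Data.Vec using (tabulate)
open import Algebra.Properties.CommutativeMonoid.Sum ℕ.+-0-commutativeMonoid
  using (sum-syntax)
open import Level using (0ℓ)
open import Relation.Binary using (Rel; Decidable; Symmetric)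
open import Relation.Binary.PropositionalEquality
  using (_≡_; _≢_; sym; trans; cong; cong₂; subst)
open import Relation.Nullary using (¬_; does; _×-dec_)
open import Relation.Nullary.Decidable using (dec⇒maybe)
open import Tactic.RingSolver using (solve-∀)
open import Tactic.RingSolver.Core.AlmostCommutativeRing
  using (AlmostCommutativeRing; fromCommutativeRing)

record SimpleGraph (v : ℕ) : Set₁ where
  field
    Adj     : Rel (Fin v) 0ℓ
    adj?    : Decidable Adj
    adj-sym : Symmetric Adj
    irrefl  : ∀ u → ¬ Adj u u

module _ {v : ℕ} (Γ : SimpleGraph v) where
  open SimpleGraph Γ

  neighbours : Fin v → Subset v
  neighbours u = tabulate (λ w → does (adj? u w))

  deg : Fin v → ℕ
  deg u = ∣ neighbours u ∣

  IsClique : ℕ → Subset v → Set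
  IsClique s S = (∣ S ∣ ≡ s) × (∀ {u w} → u ∈ S → w ∈ S → u ≢ w → Adj u w)

  Σdeg : Subset v → ℕ
  Σdeg S = ∑[ u < v ] (if does (u ∈? S) then deg u else 0)

  -- Each 2-subset {u, w} of S is counted once, as the pair with u < w.
  Σcommon : Subset v → ℕ
  Σcommon S = ∑[ u < v ] ∑[ w < v ]
    (if does ((u ∈? S) ×-dec (w ∈? S) ×-dec (u <? w))
     then ∣ neighbours u ∩ neighbours w ∣ else 0)

-- The average of n values with the given total; an empty average is 0.
average : (total n : ℕ) → ℚ
average total zero      = 0ℚ
average total n@(suc _) = ℤ.+ total ℚ./ n

⟨k⟩ : ∀ {v} → SimpleGraph v → Subset v → ℚ
⟨k⟩ Γ S = average (Σdeg Γ S) ∣ S ∣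

⟨λ⟩ : ∀ {v} → SimpleGraph v → Subset v → ℚ
⟨λ⟩ Γ S = average (Σcommon Γ S) (∣ S ∣ C 2)

-- Real numbers are Cauchy sequences of rationals, compared with the setoid
-- equality _≃_ below.

IsCauchy : (ℕ → ℚ) → Set
IsCauchy f = ∀ ε → 0ℚ ℚ.< ε →
  ∃[ N ] (∀ m n → N ℕ.≤ m → N ℕ.≤ n → ℚ.∣ f m ℚ.- f n ∣ ℚ.≤ ε)

record ℝ : Set where
  constructor mkℝ
  field
    seq    : ℕ → ℚ
    cauchy : IsCauchy seq

open ℝ public

module CauchyLemmas where
  open ℚ.≤-Reasoning

  ℚ-ring : AlmostCommutativeRing 0ℓ 0ℓ
  ℚ-ring = fromCommutativeRing ℚ.+-*-commutativeRing
                               (λ p → dec⇒maybe (0ℚ ℚ.≟ p))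

  abstract

    split : ∀ a b → a ≡ (a ℚ.+ ℚ.- b) ℚ.+ b
    split = solve-∀ ℚ-ring

    cancel : ∀ a b → (a ℚ.+ b) ℚ.+ ℚ.- b ≡ a
    cancel = solve-∀ ℚ-ring

    neg-minus : ∀ a b → ℚ.- (a ℚ.+ ℚ.- b) ≡ b ℚ.+ ℚ.- a
    neg-minus = solve-∀ ℚ-ring

    minus-neg : ∀ a b → (ℚ.- a) ℚ.+ ℚ.- (ℚ.- b) ≡ b ℚ.+ ℚ.- a
    minus-neg = solve-∀ ℚ-ring

    minus-+ : ∀ a b c d → (a ℚ.+ b) ℚ.+ ℚ.- (c ℚ.+ d) ≡
                          (a ℚ.+ ℚ.- c) ℚ.+ (b ℚ.+ ℚ.- d)
    minus-+ = solve-∀ ℚ-ring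

    minus-* : ∀ a b c d → (a ℚ.* b) ℚ.+ ℚ.- (c ℚ.* d) ≡
                          a ℚ.* (b ℚ.+ ℚ.- d) ℚ.+ d ℚ.* (a ℚ.+ ℚ.- c)
    minus-* = solve-∀ ℚ-ring

    double : ∀ a → a ℚ.+ a ≡ (1ℚ ℚ.+ 1ℚ) ℚ.* a
    double a = sym (trans (ℚ.*-distribʳ-+ a 1ℚ 1ℚ)
                          (cong₂ ℚ._+_ (ℚ.*-identityˡ a) (ℚ.*-identityˡ a)))

    shrink : ∀ ε B → 0ℚ ℚ.< ε → 0ℚ ℚ.< B →
             ∃[ δ ] (0ℚ ℚ.< δ × B ℚ.* δ ≡ ε)
    shrink ε B 0<ε 0<B = δ , ℚ.positive⁻¹ δ {{δ-pos}} , eq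
      where
      instance
        ε-pos : ℚ.Positive ε
        ε-pos = ℚ.positive 0<ε
        B-pos : ℚ.Positive B
        B-pos = ℚ.positive 0<B
        B-nonZero : ℚ.NonZero B
        B-nonZero = ℚ.pos⇒nonZero B
        1/B-pos : ℚ.Positive (ℚ.1/ B)
        1/B-pos = ℚ.1/pos⇒pos B
      δ : ℚ
      δ = ℚ.1/ B ℚ.* ε
      δ-pos : ℚ.Positive δ
      δ-pos = ℚ.pos*pos⇒pos (ℚ.1/ B) ε
      eq : B ℚ.* δ ≡ ε
      eq = trans (sym (ℚ.*-assoc B (ℚ.1/ B) ε))
          (trans (cong (ℚ._* ε) (ℚ.*-inverseʳ B)) (ℚ.*-identityˡ ε))

    1≤1+∣p∣ : ∀ p → 1ℚ ℚ.≤ 1ℚ ℚ.+ ℚ.∣ p ∣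
    1≤1+∣p∣ p = ℚ.+-monoʳ-≤ 1ℚ (ℚ.0≤∣p∣ p)

    0<1+∣p∣ : ∀ p → 0ℚ ℚ.< 1ℚ ℚ.+ ℚ.∣ p ∣
    0<1+∣p∣ p = ℚ.<-≤-trans (ℚ.positive⁻¹ 1ℚ) (1≤1+∣p∣ p)

    ∣p∣-∣q∣≤∣p-q∣ : ∀ p q → ℚ.∣ p ∣ ℚ.- ℚ.∣ q ∣ ℚ.≤ ℚ.∣ p ℚ.- q ∣
    ∣p∣-∣q∣≤∣p-q∣ p q = begin
      ℚ.∣ p ∣ ℚ.- ℚ.∣ q ∣
        ≡⟨ cong (λ r → ℚ.∣ r ∣ ℚ.- ℚ.∣ q ∣) (split p q) ⟩
      ℚ.∣ (p ℚ.- q) ℚ.+ q ∣ ℚ.- ℚ.∣ q ∣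
        ≤⟨ ℚ.+-monoˡ-≤ (ℚ.- ℚ.∣ q ∣) (ℚ.∣p+q∣≤∣p∣+∣q∣ (p ℚ.- q) q) ⟩
      (ℚ.∣ p ℚ.- q ∣ ℚ.+ ℚ.∣ q ∣) ℚ.- ℚ.∣ q ∣
        ≡⟨ cancel ℚ.∣ p ℚ.- q ∣ ℚ.∣ q ∣ ⟩
      ℚ.∣ p ℚ.- q ∣ ∎

    ∣p-q∣≡∣q-p∣ : ∀ p q → ℚ.∣ p ℚ.- q ∣ ≡ ℚ.∣ q ℚ.- p ∣
    ∣p-q∣≡∣q-p∣ p q = trans (sym (ℚ.∣-p∣≡∣p∣ (p ℚ.- q)))
      (cong ℚ.∣_∣ (neg-minus p q))

    ∣∣p∣-∣q∣∣≤∣p-q∣ : ∀ p q → ℚ.∣ ℚ.∣ p ∣ ℚ.- ℚ.∣ q ∣ ∣ ℚ.≤ ℚ.∣ p ℚ.- q ∣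
    ∣∣p∣-∣q∣∣≤∣p-q∣ p q with ℚ.∣p∣≡p∨∣p∣≡-p (ℚ.∣ p ∣ ℚ.- ℚ.∣ q ∣)
    ... | inj₁ eq = subst (ℚ._≤ ℚ.∣ p ℚ.- q ∣) (sym eq) (∣p∣-∣q∣≤∣p-q∣ p q)
    ... | inj₂ eq = begin
      ℚ.∣ ℚ.∣ p ∣ ℚ.- ℚ.∣ q ∣ ∣  ≡⟨ eq ⟩
      ℚ.- (ℚ.∣ p ∣ ℚ.- ℚ.∣ q ∣)
        ≡⟨ neg-minus ℚ.∣ p ∣ ℚ.∣ q ∣ ⟩
      ℚ.∣ q ∣ ℚ.- ℚ.∣ p ∣        ≤⟨ ∣p∣-∣q∣≤∣p-q∣ q p ⟩
      ℚ.∣ q ℚ.- p ∣              ≡⟨ ∣p-q∣≡∣q-p∣ q p ⟩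
      ℚ.∣ p ℚ.- q ∣              ∎

    cauchy-const : ∀ q → IsCauchy (λ _ → q)
    cauchy-const q ε 0<ε = 0 , λ _ _ _ _ →
      subst (λ r → ℚ.∣ r ∣ ℚ.≤ ε) (sym (ℚ.+-inverseʳ q)) (ℚ.<⇒≤ 0<ε)

    cauchy-neg : ∀ f → IsCauchy f → IsCauchy (λ n → ℚ.- f n)
    cauchy-neg f cf ε 0<ε with cf ε 0<ε
    ... | N , bound = N , λ m n N≤m N≤n → begin
      ℚ.∣ ℚ.- f m ℚ.- ℚ.- f n ∣
        ≡⟨ cong ℚ.∣_∣ (minus-neg (f m) (f n)) ⟩
      ℚ.∣ f n ℚ.- f m ∣  ≤⟨ bound n m N≤n N≤m ⟩
      ε                  ∎

    cauchy-abs : ∀ f → IsCauchy f → IsCauchy (λ n → ℚ.∣ f n ∣)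
    cauchy-abs f cf ε 0<ε with cf ε 0<ε
    ... | N , bound = N , λ m n N≤m N≤n →
      ℚ.≤-trans (∣∣p∣-∣q∣∣≤∣p-q∣ (f m) (f n)) (bound m n N≤m N≤n)

    cauchy-+ : ∀ f g → IsCauchy f → IsCauchy g → IsCauchy (λ n → f n ℚ.+ g n)
    cauchy-+ f g cf cg ε 0<ε
      with shrink ε (1ℚ ℚ.+ 1ℚ) 0<ε (ℚ.positive⁻¹ (1ℚ ℚ.+ 1ℚ))
    ... | δ , 0<δ , 2δ≡ε with cf δ 0<δ | cg δ 0<δ
    ... | M , boundf | N , boundg = M ℕ.⊔ N , λ m n ≤m ≤n → begin
      ℚ.∣ (f m ℚ.+ g m) ℚ.- (f n ℚ.+ g n) ∣
        ≡⟨ cong ℚ.∣_∣ (minus-+ (f m) (g m) (f n) (g n)) ⟩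
      ℚ.∣ (f m ℚ.- f n) ℚ.+ (g m ℚ.- g n) ∣
        ≤⟨ ℚ.∣p+q∣≤∣p∣+∣q∣ (f m ℚ.- f n) (g m ℚ.- g n) ⟩
      ℚ.∣ f m ℚ.- f n ∣ ℚ.+ ℚ.∣ g m ℚ.- g n ∣
        ≤⟨ ℚ.+-mono-≤ (boundf m n (ℕ.m⊔n≤o⇒m≤o M N ≤m) (ℕ.m⊔n≤o⇒m≤o M N ≤n))
                      (boundg m n (ℕ.m⊔n≤o⇒n≤o M N ≤m) (ℕ.m⊔n≤o⇒n≤o M N ≤n)) ⟩
      δ ℚ.+ δ
        ≡⟨ double δ ⟩
      (1ℚ ℚ.+ 1ℚ) ℚ.* δ
        ≡⟨ 2δ≡ε ⟩
      ε ∎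

    eventually-bounded : ∀ f → IsCauchy f →
      ∃[ B ] ∃[ N ] (0ℚ ℚ.< B × (∀ n → N ℕ.≤ n → ℚ.∣ f n ∣ ℚ.≤ B))
    eventually-bounded f cf with cf 1ℚ (ℚ.positive⁻¹ 1ℚ)
    ... | N , bound = 1ℚ ℚ.+ ℚ.∣ f N ∣ , N , 0<1+∣p∣ (f N) , λ n N≤n → begin
      ℚ.∣ f n ∣
        ≡⟨ cong ℚ.∣_∣ (split (f n) (f N)) ⟩
      ℚ.∣ (f n ℚ.- f N) ℚ.+ f N ∣
        ≤⟨ ℚ.∣p+q∣≤∣p∣+∣q∣ (f n ℚ.- f N) (f N) ⟩
      ℚ.∣ f n ℚ.- f N ∣ ℚ.+ ℚ.∣ f N ∣
        ≤⟨ ℚ.+-monoˡ-≤ ℚ.∣ f N ∣ (bound n N N≤n ℕ.≤-refl) ⟩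
      1ℚ ℚ.+ ℚ.∣ f N ∣ ∎

    ∣*∣-mono : ∀ {p q B δ} → 0ℚ ℚ.< B → ℚ.∣ p ∣ ℚ.≤ B → ℚ.∣ q ∣ ℚ.≤ δ →
               ℚ.∣ p ℚ.* q ∣ ℚ.≤ B ℚ.* δ
    ∣*∣-mono {p} {q} {B} {δ} 0<B p≤B q≤δ = begin
      ℚ.∣ p ℚ.* q ∣          ≡⟨ ℚ.∣p*q∣≡∣p∣*∣q∣ p q ⟩
      ℚ.∣ p ∣ ℚ.* ℚ.∣ q ∣    ≤⟨ ℚ.*-monoʳ-≤-nonNeg ℚ.∣ q ∣ {{ℚ.∣-∣-nonNeg q}} p≤B ⟩
      B ℚ.* ℚ.∣ q ∣          ≤⟨ ℚ.*-monoˡ-≤-nonNeg B {{ℚ.nonNegative (ℚ.<⇒≤ 0<B)}} q≤δ ⟩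
      B ℚ.* δ                ∎

    product-close : ∀ a b c d {A B δ ε} → 0ℚ ℚ.< A → 0ℚ ℚ.< B →
      (A ℚ.+ B) ℚ.* δ ≡ ε → ℚ.∣ a ∣ ℚ.≤ A → ℚ.∣ d ∣ ℚ.≤ B →
      ℚ.∣ a ℚ.- c ∣ ℚ.≤ δ → ℚ.∣ b ℚ.- d ∣ ℚ.≤ δ →
      ℚ.∣ a ℚ.* b ℚ.- c ℚ.* d ∣ ℚ.≤ ε
    product-close a b c d {A} {B} {δ} {ε} 0<A 0<B [A+B]δ≡ε a≤A d≤B ac bd = begin
      ℚ.∣ a ℚ.* b ℚ.- c ℚ.* d ∣
        ≡⟨ cong ℚ.∣_∣ (minus-* a b c d) ⟩
      ℚ.∣ a ℚ.* (b ℚ.- d) ℚ.+ d ℚ.* (a ℚ.- c) ∣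
        ≤⟨ ℚ.∣p+q∣≤∣p∣+∣q∣ (a ℚ.* (b ℚ.- d)) (d ℚ.* (a ℚ.- c)) ⟩
      ℚ.∣ a ℚ.* (b ℚ.- d) ∣ ℚ.+ ℚ.∣ d ℚ.* (a ℚ.- c) ∣
        ≤⟨ ℚ.+-mono-≤ (∣*∣-mono {a} {b ℚ.- d} 0<A a≤A bd)
                      (∣*∣-mono {d} {a ℚ.- c} 0<B d≤B ac) ⟩
      A ℚ.* δ ℚ.+ B ℚ.* δ  ≡⟨ ℚ.*-distribʳ-+ δ A B ⟨
      (A ℚ.+ B) ℚ.* δ      ≡⟨ [A+B]δ≡ε ⟩
      ε                    ∎

    cauchy-* : ∀ f g → IsCauchy f → IsCauchy g → IsCauchy (λ n → f n ℚ.* g n)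
    cauchy-* f g cf cg ε 0<ε =
      let A , K , 0<A , f≤A = eventually-bounded f cf
          B , L , 0<B , g≤B = eventually-bounded g cg
          δ , 0<δ , [A+B]δ≡ε = shrink ε (A ℚ.+ B) 0<ε (ℚ.+-mono-< 0<A 0<B)
          M , boundf = cf δ 0<δ
          N , boundg = cg δ 0<δ
      in (K ℕ.⊔ L) ℕ.⊔ (M ℕ.⊔ N) , λ m n ≤m ≤n →
        let KL≤m = ℕ.m⊔n≤o⇒m≤o (K ℕ.⊔ L) (M ℕ.⊔ N) ≤m
            KL≤n = ℕ.m⊔n≤o⇒m≤o (K ℕ.⊔ L) (M ℕ.⊔ N) ≤n
            MN≤m = ℕ.m⊔n≤o⇒n≤o (K ℕ.⊔ L) (M ℕ.⊔ N) ≤m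
            MN≤n = ℕ.m⊔n≤o⇒n≤o (K ℕ.⊔ L) (M ℕ.⊔ N) ≤n
        in product-close (f m) (g m) (f n) (g n) 0<A 0<B [A+B]δ≡ε
             (f≤A m (ℕ.m⊔n≤o⇒m≤o K L KL≤m)) (g≤B n (ℕ.m⊔n≤o⇒n≤o K L KL≤n))
             (boundf m n (ℕ.m⊔n≤o⇒m≤o M N MN≤m) (ℕ.m⊔n≤o⇒m≤o M N MN≤n))
             (boundg m n (ℕ.m⊔n≤o⇒n≤o M N MN≤m) (ℕ.m⊔n≤o⇒n≤o M N MN≤n))

open CauchyLemmas using
  (cauchy-const; cauchy-neg; cauchy-abs; cauchy-+; cauchy-*)

infixl 6 _+_ _-_
infixl 7 _*_ _÷_
infix  8 -_
infixr 9 _^_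
infix  4 _≃_ _<_ _≤_

fromℚ : ℚ → ℝ
fromℚ q = mkℝ (λ _ → q) (cauchy-const q)

fromℤ : ℤ → ℝ
fromℤ n = fromℚ (n ℚ./ 1)

fromℕ : ℕ → ℝ
fromℕ n = fromℤ (ℤ.+ n)

_+_ : ℝ → ℝ → ℝ
x + y = mkℝ (λ n → seq x n ℚ.+ seq y n)
            (cauchy-+ (seq x) (seq y) (cauchy x) (cauchy y))

_*_ : ℝ → ℝ → ℝ
x * y = mkℝ (λ n → seq x n ℚ.* seq y n)
            (cauchy-* (seq x) (seq y) (cauchy x) (cauchy y))

-_ : ℝ → ℝ
- x = mkℝ (λ n → ℚ.- seq x n) (cauchy-neg (seq x) (cauchy x))

_-_ : ℝ → ℝ → ℝ
x - y = x + - y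

abs : ℝ → ℝ
abs x = mkℝ (λ n → ℚ.∣ seq x n ∣) (cauchy-abs (seq x) (cauchy x))

_^_ : ℝ → ℕ → ℝ
x ^ zero  = fromℕ 1
x ^ suc n = x * x ^ n

_÷_ : ℝ → (d : ℕ) .{{_ : ℕ.NonZero d}} → ℝ
x ÷ d = x * fromℚ (ℤ.+ 1 ℚ./ d)

_≃_ : ℝ → ℝ → Set
x ≃ y = ∀ ε → 0ℚ ℚ.< ε →
  ∃[ N ] (∀ n → N ℕ.≤ n → ℚ.∣ seq x n ℚ.- seq y n ∣ ℚ.≤ ε)

_<_ : ℝ → ℝ → Set
x < y = ∃[ ε ] (0ℚ ℚ.< ε ×
  ∃[ N ] (∀ n → N ℕ.≤ n → seq x n ℚ.+ ε ℚ.≤ seq y n))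

_≤_ : ℝ → ℝ → Set
x ≤ y = ¬ (y < x)

-- n = ⌊ x ⌋.  This is a relation because a floor function on ℝ is not
-- computable; every real has exactly one floor classically, and in a
-- statement whose conclusion is a negation, assuming that the floor is
-- given costs nothing constructively either.
IsFloor : ℤ → ℝ → Set
IsFloor n x = (fromℤ n ≤ x) × (x < fromℤ (ℤ.suc n))

-- λ is a keyword, so the real parameter λ is called l.

module _ (v s : ℕ) (s<v : s ℕ.< v) (k l : ℝ) where

  private
    V S : ℝ
    V = fromℕ v
    S = fromℕ s

    -- s < v makes the truncated subtraction exact.
    instance
      2[v∸s]-nonZero : ℕ.NonZero (2 ℕ.* (v ℕ.∸ s))
      2[v∸s]-nonZero =
        ℕ.m*n≢0 2 (v ℕ.∸ s) {{_}} {{ℕ.>-nonZero (ℕ.m<n⇒0<n∸m s<v)}}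

  T₁ : ℝ
  T₁ = V - (fromℕ 3 + fromℕ 2 * k) * S + fromℕ 2 * S ^ 2

  T₂ : ℝ
  T₂ = fromℕ 4 * (V - S)
       * ((fromℕ 3 + l) * S ^ 2 - S ^ 3 - (fromℕ 2 + l) * S)

  -- The real number whose fractional part occurs in T₃.
  θ : ℝ
  θ = (- V + (fromℕ 3 + fromℕ 2 * k) * S - fromℕ 2 * S ^ 2)
      ÷ (2 ℕ.* (v ℕ.∸ s))

  -- In T₃ and CE the integer n stands for ⌊ θ ⌋.
  T₃ : ℤ → ℝ
  T₃ n = (V - S)
         * (fromℕ 1 - abs (fromℕ 2 * (θ - fromℤ n) - fromℕ 1))

  CE : ℤ → ℝ
  CE n = T₁ ^ 2 - T₂ - T₃ n ^ 2

{-# OPTIONS --safe #-}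

-- Let x z be the number of neighbours of z in S and m = v − s. Double counting
-- gives ∑ x z = Σdeg and ∑ (x z)² = 2 Σcommon + Σdeg, and x z = s − 1 for z ∈ S.
-- For every integer q, (x z − q)(x z − q − 1) ≥ 0 for the m vertices z outside S;
-- summed up, this bounds Σcommon from below. On the other hand the absolute
-- value in T₃ resolves to T₃ = ± (T₁ + 2mq) with q = n or q = n + 1, and
-- T₁² − T₂ − (T₁ + 2mq)² is −4m times the quantity just shown to be nonnegative.
-- This computation takes place in ℚ, at the actual averages of S; it carries
-- over to k and l because CE is continuous.

module Submission where

open import Defs
open import Data.Bool using (Bool; true; false; _∧_; if_then_else_)
open import Data.Fin using (Fin; zero; suc; _<?_; _≟_)
open import Data.Fin.Subset using (Subset; _∈_; ∣_∣; _∩_)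
open import Data.Fin.Subset.Properties using (_∈?_; ∩-idem; ∩-comm)
open import Data.Integer as ℤ using (ℤ; 0ℤ; 1ℤ)
import Data.Integer.Properties as ℤ
import Data.Integer.Tactic.RingSolver as ℤ-Ring
open import Data.Nat as ℕ using (ℕ; zero; suc)
open import Data.Nat.Combinatorics using (_C_; nC1≡n; nCk+nC[k+1]≡[n+1]C[k+1])
import Data.Nat.Properties as ℕ
import Data.Nat.Tactic.RingSolver as ℕ-Ring
open import Data.Product using (_×_; _,_; ∃-syntax; proj₁; proj₂)
open import Data.Rational as ℚ using (ℚ; 0ℚ; 1ℚ)
import Data.Rational.Properties as ℚ
open import Data.Rational.Solver using (module +-*-Solver)
open import Data.Rational.Unnormalised as ℚᵘ using (mkℚᵘ; *≡*; *≤*)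
import Data.Rational.Unnormalised.Properties as ℚᵘ
open import Data.Sum using (_⊎_; inj₁; inj₂)
open import Data.Vec using ([]; _∷_; lookup)
open import Data.Vec.Properties using (lookup∘tabulate; lookup-zipWith)
open import Algebra.Properties.Semiring.Sum ℕ.+-*-semiring
  using (sum; sum-syntax; sum-cong-≗; sum-replicate-zero; ∑-comm; ∑-distrib-+;
         *-distribˡ-sum; *-distribʳ-sum)
open import Relation.Binary.PropositionalEquality
  using (_≡_; refl; sym; trans; cong; cong₂; subst; subst₂; module ≡-Reasoning)
open import Relation.Nullary using (¬_; does; yes; no; contradiction)

-- Indicators and finite sums of natural numbers.

χ : Bool → ℕ
χ b = if b then 1 else 0

χ-∧ : ∀ b b′ → χ (b ∧ b′) ≡ χ b ℕ.* χ b′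
χ-∧ true  b′ = sym (ℕ.+-identityʳ (χ b′))
χ-∧ false b′ = refl

χ-idem : ∀ b → χ b ℕ.* χ b ≡ χ b
χ-idem true  = refl
χ-idem false = refl

χ-* : ∀ b n → (if b then n else 0) ≡ χ b ℕ.* n
χ-* true  n = sym (ℕ.+-identityʳ n)
χ-* false n = refl

does-∈? : ∀ {n} (u : Fin n) (p : Subset n) → does (u ∈? p) ≡ lookup p u
does-∈? zero    (true  ∷ p) = refl
does-∈? zero    (false ∷ p) = refl
does-∈? (suc u) (_     ∷ p) = does-∈? u p

∣p∣≡∑χ : ∀ {n} (p : Subset n) → ∣ p ∣ ≡ ∑[ i < n ] χ (lookup p i)
∣p∣≡∑χ []          = refl
∣p∣≡∑χ (true  ∷ p) = cong suc (∣p∣≡∑χ p)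
∣p∣≡∑χ (false ∷ p) = ∣p∣≡∑χ p

∑-mono : ∀ {n} {f g : Fin n → ℕ} → (∀ i → f i ℕ.≤ g i) → sum f ℕ.≤ sum g
∑-mono {zero}  f≤g = ℕ.z≤n
∑-mono {suc n} f≤g = ℕ.+-mono-≤ (f≤g zero) (∑-mono (λ i → f≤g (suc i)))

∑-≟ : ∀ {n} (z : Fin n) → ∑[ u < n ] χ (does (u ≟ z)) ≡ 1
∑-≟ {suc n} zero    = cong suc (sum-replicate-zero n)
∑-≟ {suc n} (suc z) = ∑-≟ z

-- By symmetry the two triangles off the diagonal have equal sums. The induction peels off row and
-- column `zero`, which agree by `h-sym` and so contribute `row` twice.
∑∑-symmetric : ∀ {n} (h : Fin n → Fin n → ℕ) → (∀ u w → h u w ≡ h w u) →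
  ∑[ u < n ] ∑[ w < n ] h u w ≡
  2 ℕ.* (∑[ u < n ] ∑[ w < n ] (χ (does (u <? w)) ℕ.* h u w)) ℕ.+ ∑[ u < n ] h u u
∑∑-symmetric {zero}  h h-sym = refl
∑∑-symmetric {suc n} h h-sym = begin
  (d ℕ.+ row) ℕ.+ ∑[ u < n ] (h (suc u) zero ℕ.+ ∑[ w < n ] h (suc u) (suc w))
    ≡⟨ cong (d ℕ.+ row ℕ.+_)
         (trans (∑-distrib-+ (λ u → h (suc u) zero) _)
           (cong₂ ℕ._+_ (sum-cong-≗ (λ u → h-sym (suc u) zero))
             (∑∑-symmetric (λ u w → h (suc u) (suc w)) (λ u w → h-sym (suc u) (suc w))))) ⟩
  (d ℕ.+ row) ℕ.+ (row ℕ.+ (2 ℕ.* below ℕ.+ diag))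
    ≡⟨ arrange d row below diag ⟩
  2 ℕ.* (row ℕ.+ below) ℕ.+ (d ℕ.+ diag)
    -- The indicator of `zero < suc w` computes to 1, those of `zero < zero` and `suc u < zero` to
    -- 0; only the factor 1 has to be inserted by hand.
    ≡⟨ cong (λ r → 2 ℕ.* (r ℕ.+ below) ℕ.+ (d ℕ.+ diag))
         (sum-cong-≗ (λ w → sym (ℕ.+-identityʳ (h zero (suc w))))) ⟩
  2 ℕ.* (∑[ w < n ] (1 ℕ.* h zero (suc w)) ℕ.+ below) ℕ.+ (d ℕ.+ diag) ∎
  where
  open ≡-Reasoning
  d row below diag : ℕ
  d     = h zero zero
  row   = ∑[ w < n ] h zero (suc w)
  below = ∑[ u < n ] ∑[ w < n ] (χ (does (u <? w)) ℕ.* h (suc u) (suc w))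
  diag  = ∑[ u < n ] h (suc u) (suc u)
  arrange : ∀ d r b g → (d ℕ.+ r) ℕ.+ (r ℕ.+ (2 ℕ.* b ℕ.+ g)) ≡
                        2 ℕ.* (r ℕ.+ b) ℕ.+ (d ℕ.+ g)
  arrange = ℕ-Ring.solve-∀

-- Double counting of neighbours in `S`.

module Counting {v : ℕ} (Γ : SimpleGraph v) (S : Subset v) where
  open SimpleGraph Γ
  open ≡-Reasoning

  [_~_] : Fin v → Fin v → ℕ
  [ u ~ w ] = χ (does (adj? u w))

  [_∈S] : Fin v → ℕ
  [ u ∈S] = χ (does (u ∈? S))

  -- This is the `x z` of the overview.
  degIn : Fin v → ℕ
  degIn z = ∑[ u < v ] ([ u ∈S] ℕ.* [ u ~ z ])

  lookup-neighbours : ∀ u z → lookup (neighbours Γ u) z ≡ does (adj? u z)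
  lookup-neighbours u = lookup∘tabulate (λ z → does (adj? u z))

  deg-∑ : ∀ u → deg Γ u ≡ ∑[ z < v ] [ u ~ z ]
  deg-∑ u = trans (∣p∣≡∑χ (neighbours Γ u))
    (sum-cong-≗ (λ z → cong χ (lookup-neighbours u z)))

  ∣S∣-∑ : ∣ S ∣ ≡ ∑[ u < v ] [ u ∈S]
  ∣S∣-∑ = trans (∣p∣≡∑χ S) (sum-cong-≗ (λ u → cong χ (sym (does-∈? u S))))

  common : Fin v → Fin v → ℕ
  common u w = ∣ neighbours Γ u ∩ neighbours Γ w ∣

  common-∑ : ∀ u w → common u w ≡ ∑[ z < v ] ([ u ~ z ] ℕ.* [ w ~ z ])
  common-∑ u w = trans (∣p∣≡∑χ (neighbours Γ u ∩ neighbours Γ w)) (sum-cong-≗ λ z →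
    trans (cong χ (trans (lookup-zipWith _∧_ z (neighbours Γ u) (neighbours Γ w))
                         (cong₂ _∧_ (lookup-neighbours u z) (lookup-neighbours w z))))
          (χ-∧ (does (adj? u z)) (does (adj? w z))))

  ∑-degIn : ∑[ z < v ] degIn z ≡ Σdeg Γ S
  ∑-degIn = sym (begin
    Σdeg Γ S
      ≡⟨ sum-cong-≗ (λ u → χ-* (does (u ∈? S)) (deg Γ u)) ⟩
    ∑[ u < v ] ([ u ∈S] ℕ.* deg Γ u)
      ≡⟨ sum-cong-≗ (λ u → cong ([ u ∈S] ℕ.*_) (deg-∑ u)) ⟩
    ∑[ u < v ] ([ u ∈S] ℕ.* ∑[ z < v ] [ u ~ z ])
      ≡⟨ sum-cong-≗ (λ u → *-distribˡ-sum [ u ∈S] (λ z → [ u ~ z ])) ⟩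
    ∑[ u < v ] ∑[ z < v ] ([ u ∈S] ℕ.* [ u ~ z ])
      ≡⟨ ∑-comm (λ u z → [ u ∈S] ℕ.* [ u ~ z ]) ⟩
    ∑[ z < v ] degIn z ∎)

  -- Ordered pairs, diagonal included, because these are what squaring `degIn` produces.
  inPair : Fin v → Fin v → ℕ
  inPair u w = [ u ∈S] ℕ.* [ w ∈S] ℕ.* common u w

  inPair-∑ : ∀ u w → inPair u w ≡
    ∑[ z < v ] (([ u ∈S] ℕ.* [ u ~ z ]) ℕ.* ([ w ∈S] ℕ.* [ w ~ z ]))
  inPair-∑ u w = begin
    [ u ∈S] ℕ.* [ w ∈S] ℕ.* common u w
      ≡⟨ cong ([ u ∈S] ℕ.* [ w ∈S] ℕ.*_) (common-∑ u w) ⟩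
    [ u ∈S] ℕ.* [ w ∈S] ℕ.* ∑[ z < v ] ([ u ~ z ] ℕ.* [ w ~ z ])
      ≡⟨ *-distribˡ-sum ([ u ∈S] ℕ.* [ w ∈S]) (λ z → [ u ~ z ] ℕ.* [ w ~ z ]) ⟩
    ∑[ z < v ] ([ u ∈S] ℕ.* [ w ∈S] ℕ.* ([ u ~ z ] ℕ.* [ w ~ z ]))
      ≡⟨ sum-cong-≗ (λ z → arrange [ u ∈S] [ w ∈S] [ u ~ z ] [ w ~ z ]) ⟩
    ∑[ z < v ] (([ u ∈S] ℕ.* [ u ~ z ]) ℕ.* ([ w ∈S] ℕ.* [ w ~ z ])) ∎
    where
    arrange : ∀ a b c d → a ℕ.* b ℕ.* (c ℕ.* d) ≡ (a ℕ.* c) ℕ.* (b ℕ.* d)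
    arrange = ℕ-Ring.solve-∀

  inPair-sym : ∀ u w → inPair u w ≡ inPair w u
  inPair-sym u w = cong₂ ℕ._*_ (ℕ.*-comm [ u ∈S] [ w ∈S])
    (cong ∣_∣ (∩-comm (neighbours Γ u) (neighbours Γ w)))

  -- Each 2-subset of `S` occurs in two orders, whence `2 Σcommon`; on the diagonal the common
  -- neighbours of `u` and `u` are all neighbours of `u`, whence `Σdeg`.
  ∑-inPair : ∑[ u < v ] ∑[ w < v ] inPair u w ≡ 2 ℕ.* Σcommon Γ S ℕ.+ Σdeg Γ S
  ∑-inPair = trans (∑∑-symmetric inPair inPair-sym) (cong₂ (λ p q → 2 ℕ.* p ℕ.+ q)
    (sum-cong-≗ λ u → sum-cong-≗ λ w →
      ordered (does (u ∈? S)) (does (w ∈? S)) (does (u <? w)) (common u w))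
    (sum-cong-≗ λ u → begin
      [ u ∈S] ℕ.* [ u ∈S] ℕ.* common u u
        ≡⟨ cong₂ ℕ._*_ (χ-idem (does (u ∈? S))) (cong ∣_∣ (∩-idem (neighbours Γ u))) ⟩
      [ u ∈S] ℕ.* deg Γ u
        ≡⟨ χ-* (does (u ∈? S)) (deg Γ u) ⟨
      (if does (u ∈? S) then deg Γ u else 0) ∎))
    where
    ordered : ∀ b b′ b″ n → χ b″ ℕ.* (χ b ℕ.* χ b′ ℕ.* n) ≡ (if b ∧ b′ ∧ b″ then n else 0)
    ordered b b′ b″ n = begin
      χ b″ ℕ.* (χ b ℕ.* χ b′ ℕ.* n)   ≡⟨ arrange (χ b) (χ b′) (χ b″) n ⟩
      χ b ℕ.* (χ b′ ℕ.* χ b″) ℕ.* n   ≡⟨ cong (λ m → χ b ℕ.* m ℕ.* n) (χ-∧ b′ b″) ⟨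
      χ b ℕ.* χ (b′ ∧ b″) ℕ.* n       ≡⟨ cong (ℕ._* n) (χ-∧ b (b′ ∧ b″)) ⟨
      χ (b ∧ b′ ∧ b″) ℕ.* n           ≡⟨ χ-* (b ∧ b′ ∧ b″) n ⟨
      (if b ∧ b′ ∧ b″ then n else 0)  ∎
      where
      arrange : ∀ a b c n → c ℕ.* (a ℕ.* b ℕ.* n) ≡ a ℕ.* (b ℕ.* c) ℕ.* n
      arrange = ℕ-Ring.solve-∀

  -- Both sides count triples `(z, u, w)` with `u` and `w` in `S` adjacent to `z`; the sum over `z`
  -- is moved innermost, where it becomes a number of common neighbours.
  ∑-degIn² : ∑[ z < v ] (degIn z ℕ.* degIn z) ≡ 2 ℕ.* Σcommon Γ S ℕ.+ Σdeg Γ S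
  ∑-degIn² = begin
    ∑[ z < v ] (degIn z ℕ.* degIn z)
      ≡⟨ sum-cong-≗ (λ z → trans (*-distribʳ-sum (degIn z) (λ u → e u z))
           (sum-cong-≗ (λ u → *-distribˡ-sum (e u z) (λ w → e w z)))) ⟩
    ∑[ z < v ] ∑[ u < v ] ∑[ w < v ] (e u z ℕ.* e w z)
      ≡⟨ ∑-comm (λ z u → ∑[ w < v ] (e u z ℕ.* e w z)) ⟩
    ∑[ u < v ] ∑[ z < v ] ∑[ w < v ] (e u z ℕ.* e w z)
      ≡⟨ sum-cong-≗ (λ u → ∑-comm (λ z w → e u z ℕ.* e w z)) ⟩
    ∑[ u < v ] ∑[ w < v ] ∑[ z < v ] (e u z ℕ.* e w z)
      ≡⟨ sum-cong-≗ (λ u → sum-cong-≗ (λ w → sym (inPair-∑ u w))) ⟩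
    ∑[ u < v ] ∑[ w < v ] inPair u w
      ≡⟨ ∑-inPair ⟩
    2 ℕ.* Σcommon Γ S ℕ.+ Σdeg Γ S ∎
    where
    e : Fin v → Fin v → ℕ
    e u z = [ u ∈S] ℕ.* [ u ~ z ]

  degIn≤∣S∣ : ∀ z → degIn z ℕ.≤ ∣ S ∣
  degIn≤∣S∣ z = subst (degIn z ℕ.≤_) (sym ∣S∣-∑) (∑-mono λ u → χ-*-≤ [ u ∈S] (does (adj? u z)))
    where
    χ-*-≤ : ∀ n b → n ℕ.* χ b ℕ.≤ n
    χ-*-≤ n true  = ℕ.≤-reflexive (ℕ.*-identityʳ n)
    χ-*-≤ n false = subst (ℕ._≤ n) (sym (ℕ.*-zeroʳ n)) ℕ.z≤n

  -- Makes the default value 0 of the empty average of `λ` harmless. Here every `degIn z` is at most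
  -- 1, hence at least its own square, and comparing the two sums leaves `2 Σcommon ≤ 0`.
  Σcommon-∣S∣≤1 : ∣ S ∣ ℕ.≤ 1 → Σcommon Γ S ≡ 0
  Σcommon-∣S∣≤1 ∣S∣≤1 = ℕ.n≤0⇒n≡0 (ℕ.≤-trans (ℕ.m≤m+n (Σcommon Γ S) _)
    (ℕ.+-cancelʳ-≤ (Σdeg Γ S) (2 ℕ.* Σcommon Γ S) 0
      (subst₂ ℕ._≤_ ∑-degIn² ∑-degIn (∑-mono λ z → n≤1⇒n²≤n (ℕ.≤-trans (degIn≤∣S∣ z) ∣S∣≤1)))))
    where
    n≤1⇒n²≤n : ∀ {n} → n ℕ.≤ 1 → n ℕ.* n ℕ.≤ n
    n≤1⇒n²≤n ℕ.z≤n           = ℕ.z≤n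
    n≤1⇒n²≤n (ℕ.s≤s ℕ.z≤n) = ℕ.≤-refl

  -- The only vertex of `S` not adjacent to `z` is `z` itself, so adding the indicator of `z` turns
  -- the sum into that of all of `S`. Writing `+ 1` on the left avoids truncated subtraction.
  degIn-clique : ∀ {s} → IsClique Γ s S → ∀ z → z ∈ S → degIn z ℕ.+ 1 ≡ s
  degIn-clique (∣S∣≡s , adjacent) z z∈S = begin
    degIn z ℕ.+ 1
      ≡⟨ cong (degIn z ℕ.+_) (∑-≟ z) ⟨
    degIn z ℕ.+ ∑[ u < v ] χ (does (u ≟ z))
      ≡⟨ ∑-distrib-+ (λ u → [ u ∈S] ℕ.* [ u ~ z ]) (λ u → χ (does (u ≟ z))) ⟨
    ∑[ u < v ] ([ u ∈S] ℕ.* [ u ~ z ] ℕ.+ χ (does (u ≟ z)))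
      ≡⟨ sum-cong-≗ pointwise ⟩
    ∑[ u < v ] [ u ∈S]
      ≡⟨ ∣S∣-∑ ⟨
    ∣ S ∣
      ≡⟨ ∣S∣≡s ⟩
    _ ∎
    where
    pointwise : ∀ u → [ u ∈S] ℕ.* [ u ~ z ] ℕ.+ χ (does (u ≟ z)) ≡ [ u ∈S]
    pointwise u with u ≟ z | adj? u z | u ∈? S
    ... | yes refl | yes u~u | _       = contradiction u~u (irrefl u)
    ... | yes refl | no _    | yes _   = refl
    ... | yes refl | no _    | no u∉S  = contradiction z∈S u∉S
    ... | no _     | _       | no _    = refl
    ... | no _     | yes _   | yes _   = refl
    ... | no u≢z   | no u≁z  | yes u∈S = contradiction (adjacent u∈S z∈S u≢z) u≁z

-- The integer inequality for a clique.

-- Consecutive integers never have opposite strict signs. This is where integrality enters the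
-- bound.
i[i-1]≥0 : ∀ i → 0ℤ ℤ.≤ i ℤ.* (i ℤ.- 1ℤ)
i[i-1]≥0 (ℤ.+ zero)  = ℤ.≤-refl
i[i-1]≥0 ℤ.+[1+ n ]  = subst (0ℤ ℤ.≤_) (ℤ.pos-* (suc n) n) (ℤ.+≤+ ℕ.z≤n)
i[i-1]≥0 ℤ.-[1+ n ]  = ℤ.+≤+ ℕ.z≤n

-- The right side is the sum of the expanded products `(x - q)(x - q - 1)`. With `c` the indicator
-- of `S`, the one lower bound `c z * K` serves both kinds of vertices: `K` inside `S`, 0 outside.
∑-quadratic-≥ : ∀ {n} (c x : Fin n → ℕ) (q K : ℤ) →
  (∀ z → ℤ.+ c z ℤ.* K ℤ.≤ (ℤ.+ x z ℤ.- q) ℤ.* (ℤ.+ x z ℤ.- q ℤ.- 1ℤ)) →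
  ℤ.+ sum c ℤ.* K ℤ.≤
  ℤ.+ sum (λ z → x z ℕ.* x z) ℤ.- (1ℤ ℤ.+ q ℤ.+ q) ℤ.* ℤ.+ sum x ℤ.+ ℤ.+ n ℤ.* (q ℤ.* (q ℤ.+ 1ℤ))
∑-quadratic-≥ {zero}  c x q K le = ℤ.≤-reflexive (zeros q)
  where
  zeros : ∀ q → 0ℤ ≡ 0ℤ ℤ.- (1ℤ ℤ.+ q ℤ.+ q) ℤ.* 0ℤ ℤ.+ 0ℤ
  zeros = ℤ-Ring.solve-∀
∑-quadratic-≥ {suc n} c x q K le = begin
  ℤ.+ (c₀ ℕ.+ C) ℤ.* K
    ≡⟨ ℤ.*-distribʳ-+ K (ℤ.+ c₀) (ℤ.+ C) ⟩
  ℤ.+ c₀ ℤ.* K ℤ.+ ℤ.+ C ℤ.* K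
    ≤⟨ ℤ.+-mono-≤ (le zero) (∑-quadratic-≥ (λ z → c (suc z)) (λ z → x (suc z)) q K
         (λ z → le (suc z))) ⟩
  (ℤ.+ x₀ ℤ.- q) ℤ.* (ℤ.+ x₀ ℤ.- q ℤ.- 1ℤ)
    ℤ.+ (ℤ.+ Q ℤ.- (1ℤ ℤ.+ q ℤ.+ q) ℤ.* ℤ.+ X ℤ.+ ℤ.+ n ℤ.* (q ℤ.* (q ℤ.+ 1ℤ)))
    ≡⟨ arrange (ℤ.+ x₀) (ℤ.+ X) (ℤ.+ Q) (ℤ.+ n) q ⟩
  (ℤ.+ x₀ ℤ.* ℤ.+ x₀ ℤ.+ ℤ.+ Q) ℤ.- (1ℤ ℤ.+ q ℤ.+ q) ℤ.* (ℤ.+ x₀ ℤ.+ ℤ.+ X)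
    ℤ.+ (1ℤ ℤ.+ ℤ.+ n) ℤ.* (q ℤ.* (q ℤ.+ 1ℤ))
    -- The embedding of ℕ into ℤ respects sums by computation, but products only up to `pos-*`.
    ≡⟨ cong (λ y → y ℤ.+ ℤ.+ Q ℤ.- (1ℤ ℤ.+ q ℤ.+ q) ℤ.* (ℤ.+ x₀ ℤ.+ ℤ.+ X)
               ℤ.+ (1ℤ ℤ.+ ℤ.+ n) ℤ.* (q ℤ.* (q ℤ.+ 1ℤ))) (sym (ℤ.pos-* x₀ x₀)) ⟩
  ℤ.+ (x₀ ℕ.* x₀ ℕ.+ Q) ℤ.- (1ℤ ℤ.+ q ℤ.+ q) ℤ.* ℤ.+ (x₀ ℕ.+ X) ℤ.+ ℤ.+ suc n ℤ.* (q ℤ.* (q ℤ.+ 1ℤ)) ∎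
  where
  open ℤ.≤-Reasoning
  c₀ x₀ C X Q : ℕ
  c₀ = c zero
  x₀ = x zero
  C  = ∑[ z < n ] c (suc z)
  X  = ∑[ z < n ] x (suc z)
  Q  = ∑[ z < n ] (x (suc z) ℕ.* x (suc z))
  arrange : ∀ a X Q n q →
    (a ℤ.- q) ℤ.* (a ℤ.- q ℤ.- 1ℤ) ℤ.+ (Q ℤ.- (1ℤ ℤ.+ q ℤ.+ q) ℤ.* X ℤ.+ n ℤ.* (q ℤ.* (q ℤ.+ 1ℤ))) ≡
    (a ℤ.* a ℤ.+ Q) ℤ.- (1ℤ ℤ.+ q ℤ.+ q) ℤ.* (a ℤ.+ X) ℤ.+ (1ℤ ℤ.+ n) ℤ.* (q ℤ.* (q ℤ.+ 1ℤ))
  arrange = ℤ-Ring.solve-∀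

-- The `s` vertices of `S` contribute exactly the left side, the others something nonnegative. The
-- `Σdeg` inside the sum of squares cancels one of the `1 + 2q` copies, which leaves `2q`.
clique-inequality : ∀ {v s} (Γ : SimpleGraph v) (S : Subset v) → IsClique Γ s S → ∀ q →
  ℤ.+ s ℤ.* ((ℤ.+ s ℤ.- 1ℤ ℤ.- q) ℤ.* (ℤ.+ s ℤ.- 1ℤ ℤ.- q ℤ.- 1ℤ)) ℤ.≤
  (ℤ.+ Σcommon Γ S ℤ.+ ℤ.+ Σcommon Γ S) ℤ.- (q ℤ.+ q) ℤ.* ℤ.+ Σdeg Γ S ℤ.+ ℤ.+ v ℤ.* (q ℤ.* (q ℤ.+ 1ℤ))
clique-inequality {v} {s} Γ S clique@(∣S∣≡s , _) q = begin
  ℤ.+ s ℤ.* K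
    ≡⟨ cong (λ n → ℤ.+ n ℤ.* K) (trans (sym ∣S∣≡s) ∣S∣-∑) ⟩
  ℤ.+ sum [_∈S] ℤ.* K
    ≤⟨ ∑-quadratic-≥ [_∈S] degIn q K pointwise ⟩
  ℤ.+ sum (λ z → degIn z ℕ.* degIn z) ℤ.- (1ℤ ℤ.+ q ℤ.+ q) ℤ.* ℤ.+ sum degIn ℤ.+ W
    ≡⟨ cong₂ (λ m n → ℤ.+ m ℤ.- (1ℤ ℤ.+ q ℤ.+ q) ℤ.* ℤ.+ n ℤ.+ W) ∑-degIn² ∑-degIn ⟩
  ℤ.+ (C ℕ.+ (C ℕ.+ 0) ℕ.+ D) ℤ.- (1ℤ ℤ.+ q ℤ.+ q) ℤ.* ℤ.+ D ℤ.+ W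
    ≡⟨ arrange (ℤ.+ C) (ℤ.+ D) q W ⟩
  (ℤ.+ C ℤ.+ ℤ.+ C) ℤ.- (q ℤ.+ q) ℤ.* ℤ.+ D ℤ.+ W ∎
  where
  open ℤ.≤-Reasoning
  open Counting Γ S
  C D : ℕ
  C = Σcommon Γ S
  D = Σdeg Γ S
  K W : ℤ
  K = (ℤ.+ s ℤ.- 1ℤ ℤ.- q) ℤ.* (ℤ.+ s ℤ.- 1ℤ ℤ.- q ℤ.- 1ℤ)
  W = ℤ.+ v ℤ.* (q ℤ.* (q ℤ.+ 1ℤ))
  arrange : ∀ C D q W →
    (C ℤ.+ (C ℤ.+ 0ℤ) ℤ.+ D) ℤ.- (1ℤ ℤ.+ q ℤ.+ q) ℤ.* D ℤ.+ W ≡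
    (C ℤ.+ C) ℤ.- (q ℤ.+ q) ℤ.* D ℤ.+ W
  arrange = ℤ-Ring.solve-∀
  cancel : ∀ x → x ≡ x ℤ.+ 1ℤ ℤ.- 1ℤ
  cancel = ℤ-Ring.solve-∀
  pointwise : ∀ z → ℤ.+ [ z ∈S] ℤ.* K ℤ.≤ (ℤ.+ degIn z ℤ.- q) ℤ.* (ℤ.+ degIn z ℤ.- q ℤ.- 1ℤ)
  pointwise z with z ∈? S
  -- Outside `S` the left side computes to 0; inside, both sides agree because `degIn z` is `s - 1`.
  ... | no  _   = i[i-1]≥0 (ℤ.+ degIn z ℤ.- q)
  ... | yes z∈S = ℤ.≤-reflexive (trans (ℤ.*-identityˡ K)
    (cong (λ y → (y ℤ.- q) ℤ.* (y ℤ.- q ℤ.- 1ℤ))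
      (trans (cong (λ n → ℤ.+ n ℤ.- 1ℤ) (sym (degIn-clique clique z z∈S)))
             (sym (cancel (ℤ.+ degIn z))))))

-- Rational arithmetic of integers and averages.

-- The same expression as in `fromℤ`, so the real constants unfold to values of `ι`.
ι : ℤ → ℚ
ι i = i ℚ./ 1

-- Reduction to lowest terms blocks computation with variables, so facts about `ι` are proved for
-- unnormalised fractions, where they are cross multiplications.
toℚᵘ-/ : ∀ i d .{{_ : ℕ.NonZero d}} → ℚ.toℚᵘ (i ℚ./ d) ℚᵘ.≃ i ℚᵘ./ d
toℚᵘ-/ i (suc d) = ℚ.toℚᵘ-fromℚᵘ (mkℚᵘ i d)

ι-+ : ∀ i j → ι (i ℤ.+ j) ≡ ι i ℚ.+ ι j
ι-+ i j = ℚ.toℚᵘ-injective (begin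
  ℚ.toℚᵘ (ι (i ℤ.+ j))             ≈⟨ toℚᵘ-/ (i ℤ.+ j) 1 ⟩
  mkℚᵘ (i ℤ.+ j) 0                 ≈⟨ *≡* (arrange i j) ⟩
  mkℚᵘ i 0 ℚᵘ.+ mkℚᵘ j 0           ≈⟨ ℚᵘ.+-cong (toℚᵘ-/ i 1) (toℚᵘ-/ j 1) ⟨
  ℚ.toℚᵘ (ι i) ℚᵘ.+ ℚ.toℚᵘ (ι j)   ≈⟨ ℚ.toℚᵘ-homo-+ (ι i) (ι j) ⟨
  ℚ.toℚᵘ (ι i ℚ.+ ι j)             ∎)
  where
  open ℚᵘ.≃-Reasoning
  arrange : ∀ i j → (i ℤ.+ j) ℤ.* 1ℤ ≡ (i ℤ.* 1ℤ ℤ.+ j ℤ.* 1ℤ) ℤ.* 1ℤ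
  arrange = ℤ-Ring.solve-∀

ι-* : ∀ i j → ι (i ℤ.* j) ≡ ι i ℚ.* ι j
ι-* i j = ℚ.toℚᵘ-injective (begin
  ℚ.toℚᵘ (ι (i ℤ.* j))             ≈⟨ toℚᵘ-/ (i ℤ.* j) 1 ⟩
  mkℚᵘ i 0 ℚᵘ.* mkℚᵘ j 0           ≈⟨ ℚᵘ.*-cong (toℚᵘ-/ i 1) (toℚᵘ-/ j 1) ⟨
  ℚ.toℚᵘ (ι i) ℚᵘ.* ℚ.toℚᵘ (ι j)   ≈⟨ ℚ.toℚᵘ-homo-* (ι i) (ι j) ⟨
  ℚ.toℚᵘ (ι i ℚ.* ι j)             ∎)
  where open ℚᵘ.≃-Reasoning

ι-neg : ∀ i → ι (ℤ.- i) ≡ ℚ.- ι i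
ι-neg i = ℚ.toℚᵘ-injective (begin
  ℚ.toℚᵘ (ι (ℤ.- i))  ≈⟨ toℚᵘ-/ (ℤ.- i) 1 ⟩
  ℚᵘ.- mkℚᵘ i 0       ≈⟨ ℚᵘ.-‿cong (toℚᵘ-/ i 1) ⟨
  ℚᵘ.- ℚ.toℚᵘ (ι i)   ≈⟨ ℚ.toℚᵘ-homo‿- (ι i) ⟨
  ℚ.toℚᵘ (ℚ.- ι i)    ∎)
  where open ℚᵘ.≃-Reasoning

ι-- : ∀ i j → ι (i ℤ.- j) ≡ ι i ℚ.- ι j
ι-- i j = trans (ι-+ i (ℤ.- j)) (cong (ι i ℚ.+_) (ι-neg j))

ι-mono-≤ : ∀ {i j} → i ℤ.≤ j → ι i ℚ.≤ ι j
ι-mono-≤ {i} {j} i≤j = ℚ.toℚᵘ-cancel-≤ (begin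
  ℚ.toℚᵘ (ι i)  ≃⟨ toℚᵘ-/ i 1 ⟩
  mkℚᵘ i 0      ≤⟨ *≤* (ℤ.*-monoʳ-≤-nonNeg 1ℤ i≤j) ⟩
  mkℚᵘ j 0      ≃⟨ toℚᵘ-/ j 1 ⟨
  ℚ.toℚᵘ (ι j)  ∎)
  where open ℚᵘ.≤-Reasoning

/-*-cancel : ∀ i d .{{_ : ℕ.NonZero d}} → (i ℚ./ d) ℚ.* ι (ℤ.+ d) ≡ ι i
/-*-cancel i d@(suc _) = ℚ.toℚᵘ-injective (begin
  ℚ.toℚᵘ ((i ℚ./ d) ℚ.* ι (ℤ.+ d))             ≈⟨ ℚ.toℚᵘ-homo-* (i ℚ./ d) (ι (ℤ.+ d)) ⟩
  ℚ.toℚᵘ (i ℚ./ d) ℚᵘ.* ℚ.toℚᵘ (ι (ℤ.+ d))     ≈⟨ ℚᵘ.*-cong (toℚᵘ-/ i d) (toℚᵘ-/ (ℤ.+ d) 1) ⟩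
  (i ℚᵘ./ d) ℚᵘ.* mkℚᵘ (ℤ.+ d) 0               ≈⟨ *≡* (trans (ℤ.*-identityʳ (i ℤ.* ℤ.+ d))
                                                     (cong (λ e → i ℤ.* ℤ.+ e) (sym (ℕ.*-identityʳ d)))) ⟩
  mkℚᵘ i 0                                     ≈⟨ toℚᵘ-/ i 1 ⟨
  ℚ.toℚᵘ (ι i)                                 ∎)
  where open ℚᵘ.≃-Reasoning

-- The hypothesis is what reconciles the default average 0 at `n = 0` with the total.
average-* : ∀ total n → (n ≡ 0 → total ≡ 0) → average total n ℚ.* ι (ℤ.+ n) ≡ ι (ℤ.+ total)
average-* total zero    empty = cong (λ m → ι (ℤ.+ m)) (sym (empty refl))
average-* total (suc n) _     = /-*-cancel (ℤ.+ total) (suc n)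

-- The formula `n(n - 1)/2` without subtraction or division; induction by Pascal's rule.
nC2+nC2 : ∀ n → n C 2 ℕ.+ n C 2 ℕ.+ n ≡ n ℕ.* n
nC2+nC2 zero    = refl
nC2+nC2 (suc n) = begin
  suc n C 2 ℕ.+ suc n C 2 ℕ.+ suc n
    ≡⟨ cong (λ m → m ℕ.+ m ℕ.+ suc n) (nCk+nC[k+1]≡[n+1]C[k+1] n 1) ⟨
  (n C 1 ℕ.+ n C 2) ℕ.+ (n C 1 ℕ.+ n C 2) ℕ.+ suc n
    ≡⟨ cong (λ m → (m ℕ.+ n C 2) ℕ.+ (m ℕ.+ n C 2) ℕ.+ suc n) (nC1≡n n) ⟩
  (n ℕ.+ n C 2) ℕ.+ (n ℕ.+ n C 2) ℕ.+ suc n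
    ≡⟨ arrange n (n C 2) ⟩
  suc (n ℕ.+ n ℕ.+ (n C 2 ℕ.+ n C 2 ℕ.+ n))
    ≡⟨ cong (λ m → suc (n ℕ.+ n ℕ.+ m)) (nC2+nC2 n) ⟩
  suc (n ℕ.+ n ℕ.+ n ℕ.* n)
    ≡⟨ square n ⟨
  suc n ℕ.* suc n ∎
  where
  open ≡-Reasoning
  arrange : ∀ n c → (n ℕ.+ c) ℕ.+ (n ℕ.+ c) ℕ.+ suc n ≡ suc (n ℕ.+ n ℕ.+ (c ℕ.+ c ℕ.+ n))
  arrange = ℕ-Ring.solve-∀
  square : ∀ n → suc n ℕ.* suc n ≡ suc (n ℕ.+ n ℕ.+ n ℕ.* n)
  square = ℕ-Ring.solve-∀

nC2≡0⇒n≤1 : ∀ n → n C 2 ≡ 0 → n ℕ.≤ 1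
nC2≡0⇒n≤1 zero          _   = ℕ.z≤n
nC2≡0⇒n≤1 (suc zero)    _   = ℕ.≤-refl
nC2≡0⇒n≤1 n@(suc (suc m)) nC2≡0 = contradiction
  -- A vanishing binomial would give `n = n * n`, hence `1 = n`.
  (ℕ.*-cancelʳ-≡ 1 n n (trans (ℕ.*-identityˡ n)
    (subst (λ c → c ℕ.+ c ℕ.+ n ≡ n ℕ.* n) nC2≡0 (nC2+nC2 n))))
  λ ()

-- Polynomial identities behind `T₃` and `CE`.

-- In the application `W` is the numerator of `θ`, `M` is `v - s`, and `W * r` is `θ`. By the sign
-- inside the absolute value, `t` is `2M(n + 1) - W` or `W - 2Mn`; squaring removes the sign, so `q`
-- is `n + 1` or `n`.
T₃²-value : ∀ W M r n → r ℚ.* (ι (ℤ.+ 2) ℚ.* M) ≡ 1ℚ →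
  let t = M ℚ.* (1ℚ ℚ.- ℚ.∣ ι (ℤ.+ 2) ℚ.* (W ℚ.* r ℚ.- ι n) ℚ.- 1ℚ ∣) in
  ∃[ q ] t ℚ.* (t ℚ.* 1ℚ) ≡
         (ι (ℤ.+ 2) ℚ.* M ℚ.* ι q ℚ.- W) ℚ.* (ι (ℤ.+ 2) ℚ.* M ℚ.* ι q ℚ.- W)
T₃²-value W M r n r[2M]≡1 = resolve (ℚ.∣p∣≡p∨∣p∣≡-p (2ℚ ℚ.* (W ℚ.* r ℚ.- ι n) ℚ.- 1ℚ))
  where
  open ≡-Reasoning
  open +-*-Solver

  2ℚ u : ℚ
  2ℚ = ι (ℤ.+ 2)
  u  = 2ℚ ℚ.* (W ℚ.* r ℚ.- ι n) ℚ.- 1ℚ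

  tent² line² : ℚ → ℚ
  tent² a = M ℚ.* (1ℚ ℚ.- a) ℚ.* (M ℚ.* (1ℚ ℚ.- a) ℚ.* 1ℚ)
  line² q = (2ℚ ℚ.* M ℚ.* q ℚ.- W) ℚ.* (2ℚ ℚ.* M ℚ.* q ℚ.- W)

  -- The ring solver cannot use `r * 2M = 1`, so `W` carries this factor until the solver is done.
  scaled² : ℚ → ℚ
  scaled² q = (2ℚ ℚ.* M ℚ.* q ℚ.- W ℚ.* (r ℚ.* (2ℚ ℚ.* M))) ℚ.*
              (2ℚ ℚ.* M ℚ.* q ℚ.- W ℚ.* (r ℚ.* (2ℚ ℚ.* M)))

  scaled²≡line² : ∀ q → scaled² q ≡ line² q
  scaled²≡line² q = cong (λ w → (2ℚ ℚ.* M ℚ.* q ℚ.- w) ℚ.* (2ℚ ℚ.* M ℚ.* q ℚ.- w))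
    (trans (cong (W ℚ.*_) r[2M]≡1) (ℚ.*-identityʳ W))

  resolve : ℚ.∣ u ∣ ≡ u ⊎ ℚ.∣ u ∣ ≡ ℚ.- u → ∃[ q ] tent² ℚ.∣ u ∣ ≡ line² (ι q)
  resolve (inj₁ ∣u∣≡u) = n ℤ.+ 1ℤ , (begin
    tent² ℚ.∣ u ∣
      ≡⟨ cong tent² ∣u∣≡u ⟩
    tent² u
      ≡⟨ solve 4 (λ W M r n →
           let t = M :* (con 1ℚ :- (con 2ℚ :* (W :* r :- n) :- con 1ℚ))
               b = con 2ℚ :* M :* (n :+ con 1ℚ) :- W :* (r :* (con 2ℚ :* M))
           in t :* (t :* con 1ℚ) := b :* b) refl W M r (ι n) ⟩
    scaled² (ι n ℚ.+ 1ℚ)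
      ≡⟨ scaled²≡line² (ι n ℚ.+ 1ℚ) ⟩
    line² (ι n ℚ.+ 1ℚ)
      ≡⟨ cong line² (ι-+ n 1ℤ) ⟨
    line² (ι (n ℤ.+ 1ℤ)) ∎)
  resolve (inj₂ ∣u∣≡-u) = n , (begin
    tent² ℚ.∣ u ∣
      ≡⟨ cong tent² ∣u∣≡-u ⟩
    tent² (ℚ.- u)
      ≡⟨ solve 4 (λ W M r n →
           let t = M :* (con 1ℚ :- :- (con 2ℚ :* (W :* r :- n) :- con 1ℚ))
               b = con 2ℚ :* M :* n :- W :* (r :* (con 2ℚ :* M))
           in t :* (t :* con 1ℚ) := b :* b) refl W M r (ι n) ⟩
    scaled² (ι n)
      ≡⟨ scaled²≡line² (ι n) ⟩
    line² (ι n) ∎)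

-- With `m = V - S` and `W = - T`, the difference `T² - B²` is `-4mq(T + mq)`, which shares the
-- factor `4m` with `T₂`. The remaining factor is left side minus right side of `clique-inequality`,
-- expressed through the averages.
CE-factorisation : ∀ V S κ μ q →
  let T = V ℚ.- (ι (ℤ.+ 3) ℚ.+ ι (ℤ.+ 2) ℚ.* κ) ℚ.* S ℚ.+ ι (ℤ.+ 2) ℚ.* (S ℚ.* (S ℚ.* 1ℚ))
      W = ℚ.- V ℚ.+ (ι (ℤ.+ 3) ℚ.+ ι (ℤ.+ 2) ℚ.* κ) ℚ.* S ℚ.- ι (ℤ.+ 2) ℚ.* (S ℚ.* (S ℚ.* 1ℚ))
      B = ι (ℤ.+ 2) ℚ.* (V ℚ.- S) ℚ.* q ℚ.- W
  in T ℚ.* (T ℚ.* 1ℚ)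
     ℚ.- ι (ℤ.+ 4) ℚ.* (V ℚ.- S) ℚ.*
         ((ι (ℤ.+ 3) ℚ.+ μ) ℚ.* (S ℚ.* (S ℚ.* 1ℚ)) ℚ.- S ℚ.* (S ℚ.* (S ℚ.* 1ℚ))
          ℚ.- (ι (ℤ.+ 2) ℚ.+ μ) ℚ.* S)
     ℚ.- B ℚ.* B
     ≡ ι (ℤ.+ 4) ℚ.* (V ℚ.- S) ℚ.*
       (S ℚ.* ((S ℚ.- 1ℚ ℚ.- q) ℚ.* (S ℚ.- 1ℚ ℚ.- q ℚ.- 1ℚ))
        ℚ.- (μ ℚ.* (S ℚ.* S ℚ.- S) ℚ.- (q ℚ.+ q) ℚ.* (κ ℚ.* S) ℚ.+ V ℚ.* (q ℚ.* (q ℚ.+ 1ℚ))))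
CE-factorisation = solve 5 (λ V S κ μ q →
  let 2# = con (ι (ℤ.+ 2))
      3# = con (ι (ℤ.+ 3))
      4# = con (ι (ℤ.+ 4))
      1# = con 1ℚ
      T  = V :- (3# :+ 2# :* κ) :* S :+ 2# :* (S :* (S :* 1#))
      W  = :- V :+ (3# :+ 2# :* κ) :* S :- 2# :* (S :* (S :* 1#))
      B  = 2# :* (V :- S) :* q :- W
  in T :* (T :* 1#)
     :- 4# :* (V :- S) :* ((3# :+ μ) :* (S :* (S :* 1#)) :- S :* (S :* (S :* 1#)) :- (2# :+ μ) :* S)
     :- B :* B
     := 4# :* (V :- S) :*
        (S :* ((S :- 1# :- q) :* (S :- 1# :- q :- 1#))
         :- (μ :* (S :* S :- S) :- (q :+ q) :* (κ :* S) :+ V :* (q :* (q :+ 1#))))) refl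
  where open +-*-Solver

-- Limits of Cauchy sequences and continuity of `CE`.

open CauchyLemmas
  using (split; minus-neg; minus-+; double; shrink; 0<1+∣p∣; ∣p-q∣≡∣q-p∣;
         ∣∣p∣-∣q∣∣≤∣p-q∣; eventually-bounded; product-close)

infix 4 _⟶_

-- A record, because `≃` unfolds to a statement about `seq` from which `x` and `p` could not be
-- inferred.
record _⟶_ (x : ℝ) (p : ℚ) : Set where
  constructor lim
  field close : fromℚ p ≃ x

const-⟶ : ∀ p → fromℚ p ⟶ p
const-⟶ p = lim λ ε 0<ε → 0 , λ _ _ →
  subst (λ r → ℚ.∣ r ∣ ℚ.≤ ε) (sym (ℚ.+-inverseʳ p)) (ℚ.<⇒≤ 0<ε)

+-⟶ : ∀ {x y p q} → x ⟶ p → y ⟶ q → x + y ⟶ p ℚ.+ q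
+-⟶ {x} {y} {p} {q} (lim f) (lim g) = lim λ ε 0<ε →
  let δ , 0<δ , 2δ≡ε = shrink ε (1ℚ ℚ.+ 1ℚ) 0<ε (ℚ.positive⁻¹ (1ℚ ℚ.+ 1ℚ))
      M , boundf = f δ 0<δ
      N , boundg = g δ 0<δ
  in M ℕ.⊔ N , λ n ≤n → begin
    ℚ.∣ (p ℚ.+ q) ℚ.- (seq x n ℚ.+ seq y n) ∣
      ≡⟨ cong ℚ.∣_∣ (minus-+ p q (seq x n) (seq y n)) ⟩
    ℚ.∣ (p ℚ.- seq x n) ℚ.+ (q ℚ.- seq y n) ∣
      ≤⟨ ℚ.∣p+q∣≤∣p∣+∣q∣ (p ℚ.- seq x n) (q ℚ.- seq y n) ⟩
    ℚ.∣ p ℚ.- seq x n ∣ ℚ.+ ℚ.∣ q ℚ.- seq y n ∣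
      ≤⟨ ℚ.+-mono-≤ (boundf n (ℕ.m⊔n≤o⇒m≤o M N ≤n)) (boundg n (ℕ.m⊔n≤o⇒n≤o M N ≤n)) ⟩
    δ ℚ.+ δ
      ≡⟨ trans (double δ) 2δ≡ε ⟩
    ε ∎
  where open ℚ.≤-Reasoning

-- Rests on `pq - xy = p(q - y) + y(p - x)`, with bounds for `p` and for a tail of `y`.
*-⟶ : ∀ {x y p q} → x ⟶ p → y ⟶ q → x * y ⟶ p ℚ.* q
*-⟶ {x} {y} {p} {q} (lim f) (lim g) = lim λ ε 0<ε →
  -- The summand 1 keeps the bound positive when `p` is 0.
  let A       = 1ℚ ℚ.+ ℚ.∣ p ∣
      0<A     = 0<1+∣p∣ p
      p≤A     = subst (ℚ._≤ A) (ℚ.+-identityˡ ℚ.∣ p ∣) (ℚ.+-monoˡ-≤ ℚ.∣ p ∣ (ℚ.nonNegative⁻¹ 1ℚ))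
      B , L , 0<B , y≤B = eventually-bounded (seq y) (cauchy y)
      δ , 0<δ , [A+B]δ≡ε = shrink ε (A ℚ.+ B) 0<ε (ℚ.+-mono-< 0<A 0<B)
      M , boundf = f δ 0<δ
      N , boundg = g δ 0<δ
  in L ℕ.⊔ (M ℕ.⊔ N) , λ n ≤n →
    let MN≤n = ℕ.m⊔n≤o⇒n≤o L (M ℕ.⊔ N) ≤n
    in product-close p q (seq x n) (seq y n) 0<A 0<B [A+B]δ≡ε
         p≤A (y≤B n (ℕ.m⊔n≤o⇒m≤o L (M ℕ.⊔ N) ≤n))
         (boundf n (ℕ.m⊔n≤o⇒m≤o M N MN≤n)) (boundg n (ℕ.m⊔n≤o⇒n≤o M N MN≤n))

neg-⟶ : ∀ {x p} → x ⟶ p → - x ⟶ ℚ.- p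
neg-⟶ {x} {p} (lim f) = lim λ ε 0<ε →
  let N , bound = f ε 0<ε
  in N , λ n N≤n → subst (ℚ._≤ ε)
    (trans (∣p-q∣≡∣q-p∣ p (seq x n)) (cong ℚ.∣_∣ (sym (minus-neg p (seq x n)))))
    (bound n N≤n)

abs-⟶ : ∀ {x p} → x ⟶ p → abs x ⟶ ℚ.∣ p ∣
abs-⟶ {x} {p} (lim f) = lim λ ε 0<ε →
  let N , bound = f ε 0<ε
  in N , λ n N≤n → ℚ.≤-trans (∣∣p∣-∣q∣∣≤∣p-q∣ p (seq x n)) (bound n N≤n)

minus-⟶ : ∀ {x y p q} → x ⟶ p → y ⟶ q → x - y ⟶ p ℚ.- q
minus-⟶ f g = +-⟶ f (neg-⟶ g)

²-⟶ : ∀ {x p} → x ⟶ p → x ^ 2 ⟶ p ℚ.* (p ℚ.* 1ℚ)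
²-⟶ f = *-⟶ f (*-⟶ f (const-⟶ 1ℚ))

-- Eventually `x` would be at least `ε`, yet within `ε/2` of a nonpositive number.
⟶-≤0 : ∀ {x p} → x ⟶ p → p ℚ.≤ 0ℚ → ¬ (fromℕ 0 < x)
⟶-≤0 {x} {p} (lim f) p≤0 (ε , 0<ε , M , ε≤x) =
  let N , bound = f ½ε 0<½ε
      n = M ℕ.⊔ N
  in ℚ.<-irrefl refl (ℚ.<-≤-trans ½ε<ε (begin
    ε                      ≡⟨ ℚ.+-identityˡ ε ⟨
    0ℚ ℚ.+ ε               ≤⟨ ε≤x n (ℕ.m≤m⊔n M N) ⟩
    seq x n                ≡⟨ split (seq x n) p ⟩
    (seq x n ℚ.- p) ℚ.+ p  ≤⟨ ℚ.+-mono-≤ (p≤∣p∣ (seq x n ℚ.- p)) p≤0 ⟩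
    ℚ.∣ seq x n ℚ.- p ∣ ℚ.+ 0ℚ
      ≡⟨ trans (ℚ.+-identityʳ _) (∣p-q∣≡∣q-p∣ (seq x n) p) ⟩
    ℚ.∣ p ℚ.- seq x n ∣    ≤⟨ bound n (ℕ.m≤n⊔m M N) ⟩
    ½ε                     ∎))
  where
  open ℚ.≤-Reasoning
  halving = shrink ε (1ℚ ℚ.+ 1ℚ) 0<ε (ℚ.positive⁻¹ (1ℚ ℚ.+ 1ℚ))
  ½ε   = proj₁ halving
  0<½ε = proj₁ (proj₂ halving)
  ½ε<ε : ½ε ℚ.< ε
  ½ε<ε = subst₂ ℚ._<_ (ℚ.+-identityˡ ½ε) (trans (double ½ε) (proj₂ (proj₂ halving)))
    (ℚ.+-monoˡ-< ½ε 0<½ε)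
  p≤∣p∣ : ∀ p → p ℚ.≤ ℚ.∣ p ∣
  p≤∣p∣ p with ℚ.≤-total 0ℚ p
  ... | inj₁ 0≤p = ℚ.≤-reflexive (sym (ℚ.0≤p⇒∣p∣≡p 0≤p))
  ... | inj₂ p≤0 = ℚ.≤-trans p≤0 (ℚ.0≤∣p∣ p)

module _ {v s : ℕ} (s<v : s ℕ.< v) {k l : ℝ} {κ μ : ℚ} (k⟶κ : k ⟶ κ) (l⟶μ : l ⟶ μ) where

  -- For rational parameters every sequence involved is constant, so its entry at 0 is the rational
  -- value of the formula, which need not be written out again.
  T₁-⟶ : T₁ v s s<v k l ⟶ seq (T₁ v s s<v (fromℚ κ) (fromℚ μ)) 0
  T₁-⟶ = +-⟶ (minus-⟶ V-⟶ (*-⟶ (+-⟶ (const-⟶ _) (*-⟶ (const-⟶ _) k⟶κ)) S-⟶))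
             (*-⟶ (const-⟶ _) (²-⟶ S-⟶))
    where
    V-⟶ = const-⟶ (ℤ.+ v ℚ./ 1)
    S-⟶ = const-⟶ (ℤ.+ s ℚ./ 1)

  T₂-⟶ : T₂ v s s<v k l ⟶ seq (T₂ v s s<v (fromℚ κ) (fromℚ μ)) 0
  T₂-⟶ = *-⟶ (*-⟶ (const-⟶ _) (minus-⟶ (const-⟶ _) S-⟶))
             (minus-⟶ (minus-⟶ (*-⟶ (+-⟶ (const-⟶ _) l⟶μ) (²-⟶ S-⟶)) (*-⟶ S-⟶ (²-⟶ S-⟶)))
                  (*-⟶ (+-⟶ (const-⟶ _) l⟶μ) S-⟶))
    where
    S-⟶ = const-⟶ (ℤ.+ s ℚ./ 1)

  θ-⟶ : θ v s s<v k l ⟶ seq (θ v s s<v (fromℚ κ) (fromℚ μ)) 0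
  θ-⟶ = *-⟶ (minus-⟶ (+-⟶ (neg-⟶ (const-⟶ _)) (*-⟶ (+-⟶ (const-⟶ _) (*-⟶ (const-⟶ _) k⟶κ)) S-⟶))
                  (*-⟶ (const-⟶ _) (²-⟶ S-⟶)))
            (const-⟶ _)
    where
    S-⟶ = const-⟶ (ℤ.+ s ℚ./ 1)

  T₃-⟶ : ∀ n → T₃ v s s<v k l n ⟶ seq (T₃ v s s<v (fromℚ κ) (fromℚ μ) n) 0
  T₃-⟶ n = *-⟶ (minus-⟶ (const-⟶ _) (const-⟶ _))
    (minus-⟶ (const-⟶ _) (abs-⟶ (minus-⟶ (*-⟶ (const-⟶ _) (minus-⟶ θ-⟶ (const-⟶ _))) (const-⟶ _))))

  -- The integer `n` stays fixed while `k` and `l` are replaced by `κ` and `μ`, so the jumps of the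
  -- floor do not interfere with continuity.
  CE-⟶ : ∀ n → CE v s s<v k l n ⟶ seq (CE v s s<v (fromℚ κ) (fromℚ μ) n) 0
  CE-⟶ n = minus-⟶ (minus-⟶ (²-⟶ T₁-⟶) T₂-⟶) (²-⟶ (T₃-⟶ n))

-- The sign of `CE` at the averages of a clique.

module CliqueAverages {v s : ℕ} (Γ : SimpleGraph v) (s<v : s ℕ.< v)
                      (S : Subset v) (clique : IsClique Γ s S) where

  κ μ V Σ D Λ r 2ℚ : ℚ
  κ  = ⟨k⟩ Γ S
  μ  = ⟨λ⟩ Γ S
  V  = ι (ℤ.+ v)
  Σ  = ι (ℤ.+ s)
  D  = ι (ℤ.+ Σdeg Γ S)
  Λ  = ι (ℤ.+ Σcommon Γ S)
  2ℚ = ι (ℤ.+ 2)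

  instance
    2[v∸s]-nonZero : ℕ.NonZero (2 ℕ.* (v ℕ.∸ s))
    2[v∸s]-nonZero = ℕ.m*n≢0 2 (v ℕ.∸ s) {{_}} {{ℕ.>-nonZero (ℕ.m<n⇒0<n∸m s<v)}}

  -- The factor to which the division in `θ` unfolds.
  r = ℤ.+ 1 ℚ./ (2 ℕ.* (v ℕ.∸ s))

  ι[v∸s] : ι (ℤ.+ (v ℕ.∸ s)) ≡ V ℚ.- Σ
  ι[v∸s] = trans (cong ι (trans (sym (ℤ.⊖-≥ (ℕ.<⇒≤ s<v))) (sym (ℤ.m-n≡m⊖n v s))))
                 (ι-- (ℤ.+ v) (ℤ.+ s))

  r-inverse : r ℚ.* (2ℚ ℚ.* (V ℚ.- Σ)) ≡ 1ℚ
  r-inverse = begin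
    r ℚ.* (2ℚ ℚ.* (V ℚ.- Σ))             ≡⟨ cong (λ p → r ℚ.* (2ℚ ℚ.* p)) ι[v∸s] ⟨
    r ℚ.* (2ℚ ℚ.* ι (ℤ.+ (v ℕ.∸ s)))     ≡⟨ cong (r ℚ.*_) (ι-* (ℤ.+ 2) (ℤ.+ (v ℕ.∸ s))) ⟨
    r ℚ.* ι (ℤ.+ 2 ℤ.* ℤ.+ (v ℕ.∸ s))    ≡⟨ cong (λ i → r ℚ.* ι i) (ℤ.pos-* 2 (v ℕ.∸ s)) ⟨
    r ℚ.* ι (ℤ.+ (2 ℕ.* (v ℕ.∸ s)))      ≡⟨ /-*-cancel (ℤ.+ 1) (2 ℕ.* (v ℕ.∸ s)) ⟩
    1ℚ                                   ∎
    where open ≡-Reasoning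

  κΣ≡D : 1 ℕ.≤ s → κ ℚ.* Σ ≡ D
  κΣ≡D 1≤s = trans (cong (λ n → κ ℚ.* ι (ℤ.+ n)) (sym (proj₁ clique)))
    (average-* (Σdeg Γ S) ∣ S ∣ λ ∣S∣≡0 →
      contradiction (subst (1 ℕ.≤_) (trans (sym (proj₁ clique)) ∣S∣≡0) 1≤s) λ ())

  -- `Σ² - Σ` is twice the number of pairs, which clears the denominator of `μ`. When there are no
  -- pairs, `Σcommon-∣S∣≤1` makes both sides 0.
  μ[Σ²-Σ]≡2Λ : μ ℚ.* (Σ ℚ.* Σ ℚ.- Σ) ≡ Λ ℚ.+ Λ
  μ[Σ²-Σ]≡2Λ = begin
    μ ℚ.* (Σ ℚ.* Σ ℚ.- Σ)             ≡⟨ cong (λ n → μ ℚ.* (ι (ℤ.+ n) ℚ.* ι (ℤ.+ n) ℚ.- ι (ℤ.+ n)))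
                                              (proj₁ clique) ⟨
    μ ℚ.* (N ℚ.* N ℚ.- N)             ≡⟨ cong (λ p → μ ℚ.* (p ℚ.- N)) N²≡2P+N ⟩
    μ ℚ.* (P ℚ.+ P ℚ.+ N ℚ.- N)       ≡⟨ expand μ P N ⟩
    μ ℚ.* P ℚ.+ μ ℚ.* P               ≡⟨ cong (λ p → p ℚ.+ p) μP≡Λ ⟩
    Λ ℚ.+ Λ                           ∎
    where
    open ≡-Reasoning
    N P : ℚ
    N = ι (ℤ.+ ∣ S ∣)
    P = ι (ℤ.+ (∣ S ∣ C 2))
    expand : ∀ μ P N → μ ℚ.* (P ℚ.+ P ℚ.+ N ℚ.- N) ≡ μ ℚ.* P ℚ.+ μ ℚ.* P
    expand = solve 3 (λ μ P N → μ :* (P :+ P :+ N :- N) := μ :* P :+ μ :* P) refl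
      where open +-*-Solver
    μP≡Λ : μ ℚ.* P ≡ Λ
    μP≡Λ = average-* (Σcommon Γ S) (∣ S ∣ C 2)
      (λ eq → Counting.Σcommon-∣S∣≤1 Γ S (nC2≡0⇒n≤1 ∣ S ∣ eq))
    N²≡2P+N : N ℚ.* N ≡ P ℚ.+ P ℚ.+ N
    N²≡2P+N = begin
      N ℚ.* N
        ≡⟨ ι-* (ℤ.+ ∣ S ∣) (ℤ.+ ∣ S ∣) ⟨
      ι (ℤ.+ ∣ S ∣ ℤ.* ℤ.+ ∣ S ∣)
        ≡⟨ cong ι (ℤ.pos-* ∣ S ∣ ∣ S ∣) ⟨
      ι (ℤ.+ (∣ S ∣ ℕ.* ∣ S ∣))
        ≡⟨ cong (λ n → ι (ℤ.+ n)) (nC2+nC2 ∣ S ∣) ⟨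
      ι (ℤ.+ (∣ S ∣ C 2 ℕ.+ ∣ S ∣ C 2 ℕ.+ ∣ S ∣))
        ≡⟨ ι-+ (ℤ.+ (∣ S ∣ C 2 ℕ.+ ∣ S ∣ C 2)) (ℤ.+ ∣ S ∣) ⟩
      ι (ℤ.+ (∣ S ∣ C 2 ℕ.+ ∣ S ∣ C 2)) ℚ.+ N
        ≡⟨ cong (ℚ._+ N) (ι-+ (ℤ.+ (∣ S ∣ C 2)) (ℤ.+ (∣ S ∣ C 2))) ⟩
      P ℚ.+ P ℚ.+ N ∎

  clique-inequality-ℚ : ∀ i → let q = ι i in
    Σ ℚ.* ((Σ ℚ.- 1ℚ ℚ.- q) ℚ.* (Σ ℚ.- 1ℚ ℚ.- q ℚ.- 1ℚ)) ℚ.≤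
    (Λ ℚ.+ Λ) ℚ.- (q ℚ.+ q) ℚ.* D ℚ.+ V ℚ.* (q ℚ.* (q ℚ.+ 1ℚ))
  clique-inequality-ℚ i = subst₂ ℚ._≤_ lower upper (ι-mono-≤ (clique-inequality Γ S clique i))
    where
    c d σ : ℤ
    c = ℤ.+ Σcommon Γ S
    d = ℤ.+ Σdeg Γ S
    σ = ℤ.+ s
    σ-1-i : ι (σ ℤ.- 1ℤ ℤ.- i) ≡ Σ ℚ.- 1ℚ ℚ.- ι i
    σ-1-i = trans (ι-- (σ ℤ.- 1ℤ) i) (cong (ℚ._- ι i) (ι-- σ 1ℤ))
    lower = trans (ι-* σ ((σ ℤ.- 1ℤ ℤ.- i) ℤ.* (σ ℤ.- 1ℤ ℤ.- i ℤ.- 1ℤ))) (cong (Σ ℚ.*_)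
      (trans (ι-* (σ ℤ.- 1ℤ ℤ.- i) (σ ℤ.- 1ℤ ℤ.- i ℤ.- 1ℤ)) (cong₂ ℚ._*_ σ-1-i
        (trans (ι-- (σ ℤ.- 1ℤ ℤ.- i) 1ℤ) (cong (ℚ._- 1ℚ) σ-1-i)))))
    upper = trans (ι-+ ((c ℤ.+ c) ℤ.- (i ℤ.+ i) ℤ.* d) (ℤ.+ v ℤ.* (i ℤ.* (i ℤ.+ 1ℤ))))
      (cong₂ ℚ._+_
      (trans (ι-- (c ℤ.+ c) ((i ℤ.+ i) ℤ.* d)) (cong₂ ℚ._-_ (ι-+ c c)
        (trans (ι-* (i ℤ.+ i) d) (cong (ℚ._* D) (ι-+ i i)))))
      (trans (ι-* (ℤ.+ v) (i ℤ.* (i ℤ.+ 1ℤ))) (cong (V ℚ.*_)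
        (trans (ι-* i (i ℤ.+ 1ℤ)) (cong (ι i ℚ.*_) (ι-+ i 1ℤ))))))

  -- The factorisation at the `q` found by `T₃²-value` gives `4(V - Σ)(L - R)`, where `L ≤ R` is the
  -- clique inequality for that same `q`.
  CE≤0 : 1 ℕ.≤ s → ∀ n → seq (CE v s s<v (fromℚ κ) (fromℚ μ) n) 0 ℚ.≤ 0ℚ
  CE≤0 1≤s n = begin
    -- The entry at 0 of `CE` computes to this; the factors 1 come from `_^_`.
    T ℚ.* (T ℚ.* 1ℚ) ℚ.- T₂′ ℚ.- T₃′ ℚ.* (T₃′ ℚ.* 1ℚ)
      ≡⟨ cong (λ p → T ℚ.* (T ℚ.* 1ℚ) ℚ.- T₂′ ℚ.- p) (proj₂ T₃²) ⟩
    T ℚ.* (T ℚ.* 1ℚ) ℚ.- T₂′ ℚ.- B ℚ.* B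
      ≡⟨ CE-factorisation V Σ κ μ q ⟩
    4[V-Σ] ℚ.* (L ℚ.- (μ ℚ.* (Σ ℚ.* Σ ℚ.- Σ) ℚ.- (q ℚ.+ q) ℚ.* (κ ℚ.* Σ) ℚ.+ E))
      ≡⟨ cong₂ (λ c d → 4[V-Σ] ℚ.* (L ℚ.- (c ℚ.- (q ℚ.+ q) ℚ.* d ℚ.+ E))) μ[Σ²-Σ]≡2Λ (κΣ≡D 1≤s) ⟩
    4[V-Σ] ℚ.* (L ℚ.- R)
      ≤⟨ ℚ.*-monoˡ-≤-nonNeg 4[V-Σ] {{4[V-Σ]-nonNeg}} L-R≤0 ⟩
    4[V-Σ] ℚ.* 0ℚ
      ≡⟨ ℚ.*-zeroʳ 4[V-Σ] ⟩
    0ℚ ∎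
    where
    open ℚ.≤-Reasoning
    W T T₂′ T₃′ : ℚ
    T   = seq (T₁ v s s<v (fromℚ κ) (fromℚ μ)) 0
    T₂′ = seq (T₂ v s s<v (fromℚ κ) (fromℚ μ)) 0
    T₃′ = seq (T₃ v s s<v (fromℚ κ) (fromℚ μ) n) 0
    W   = ℚ.- V ℚ.+ (ι (ℤ.+ 3) ℚ.+ 2ℚ ℚ.* κ) ℚ.* Σ ℚ.- 2ℚ ℚ.* (Σ ℚ.* (Σ ℚ.* 1ℚ))
    T₃² = T₃²-value W (V ℚ.- Σ) r n r-inverse
    q B L E R 4[V-Σ] : ℚ
    q = ι (proj₁ T₃²)
    B = 2ℚ ℚ.* (V ℚ.- Σ) ℚ.* q ℚ.- W
    L = Σ ℚ.* ((Σ ℚ.- 1ℚ ℚ.- q) ℚ.* (Σ ℚ.- 1ℚ ℚ.- q ℚ.- 1ℚ))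
    E = V ℚ.* (q ℚ.* (q ℚ.+ 1ℚ))
    R = (Λ ℚ.+ Λ) ℚ.- (q ℚ.+ q) ℚ.* D ℚ.+ E
    4[V-Σ] = ι (ℤ.+ 4) ℚ.* (V ℚ.- Σ)
    L-R≤0 : L ℚ.- R ℚ.≤ 0ℚ
    L-R≤0 = subst (L ℚ.- R ℚ.≤_) (ℚ.+-inverseʳ R)
      (ℚ.+-monoˡ-≤ (ℚ.- R) (clique-inequality-ℚ (proj₁ T₃²)))
    4[V-Σ]-nonNeg : ℚ.NonNegative 4[V-Σ]
    4[V-Σ]-nonNeg = ℚ.nonNegative (subst (0ℚ ℚ.≤_)
      (trans (ι-* (ℤ.+ 4) (ℤ.+ (v ℕ.∸ s))) (cong (ι (ℤ.+ 4) ℚ.*_) ι[v∸s]))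
      (ι-mono-≤ {0ℤ} {ℤ.+ 4 ℤ.* ℤ.+ (v ℕ.∸ s)}
        (subst (0ℤ ℤ.≤_) (ℤ.pos-* 4 (v ℕ.∸ s)) (ℤ.+≤+ ℕ.z≤n))))

lemma3p1 : ∀ (v : ℕ) (Γ : SimpleGraph v) (s : ℕ) → 1 ℕ.≤ s → (s<v : s ℕ.< v) →
    (k l : ℝ) (n : ℤ) → IsFloor n (θ v s s<v k l) →
    fromℕ 0 < CE v s s<v k l n →
    (S : Subset v) → IsClique Γ s S →
    ¬ ((fromℚ (⟨k⟩ Γ S) ≃ k) × (fromℚ (⟨λ⟩ Γ S) ≃ l))
-- At `k` and `l` the value of `CE` is the limit of its nonpositive value at the averages of `S`,
-- hence not positive.
lemma3p1 v Γ s 1≤s s<v k l n _ 0<CE S clique (κ≃k , μ≃l) =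
  ⟶-≤0 (CE-⟶ s<v k⟶κ l⟶μ n) (CliqueAverages.CE≤0 Γ s<v S clique 1≤s n) 0<CE
  where
  k⟶κ : k ⟶ ⟨k⟩ Γ S
  k⟶κ = lim κ≃k
  l⟶μ : l ⟶ ⟨λ⟩ Γ S
  l⟶μ = lim μ≃l
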